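{- For every integer $l \ge 2$, the double domination numbers of the fractal cubic networks satisfy $\gamma_{\times 2}(FCN(l)) = 4\,\bigl(\gamma_{\times 2}(FCN(l-1)) - 1\bigr)$.
   Context: Fractal cubic network: for an integer $l\ge 0$, $FCN(l)$ is the finite simple graph whose vertices are all binary strings of length $2l+2$, defined recursively as follows. $FCN(0)$ is the 4-cycle with vertices $00, 01, 11, 10$ in this cyclic order. For $l\ge 1$, $FCN(l)$ is obtained from the disjoint union of the four copies $ab\,\Vert\,FCN(l-1)$, $a,b\in\{0,1\}$ (each vertex string of $FCN(l-1)$ is prefixed by $ab$, adjacency inside a copy being that of $FCN(l-1)$), by adding the four edges $\{00w,10w\}$, $\{10w,11w\}$, $\{11w,01w\}$, $\{01w,00w\}$, where $w=10(01)^{l-1}$ is the string $10$ followed by $l-1$ repetitions of $01$. A double dominating set of a graph $\Gamma$ is a set $D\subseteq V(\Gamma)$ such that $|N[v]\cap D|\ge 2$ for every $v\in V(\Gamma)$, where $N[v]$ is the closed neighborhood of $v$; $\gamma_{\times 2}(\Gamma)$ is the minimum size of a double dominating set. -}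

module Defs where

open import Data.Bool.Base using (Bool; true; false; T; _∧_; if_then_else_)
open import Data.Bool.Properties as Bool using (T?)
open import Data.List.Base
  using (List; []; _∷_; length; filter; filterᵇ; cartesianProductWith)
open import Data.List.Extrema.Nat using (argmin; argmin-all; f[argmin]≤v⁺)
open import Data.List.Membership.Propositional using (_∈_)
open import Data.List.Membership.Propositional.Properties
  using (∈-filter⁺; ∈-cartesianProductWith⁺)
open import Data.List.Relation.Unary.All as All using (all?)
open import Data.List.Relation.Unary.All.Properties using (all-filter)
open import Data.List.Relation.Unary.Any as Any using (here; there)
open import Data.List.Relation.Unary.Unique.Propositional using (Unique)
import Data.List.Relation.Unary.AllPairs as AllPairs
import Data.List.Relation.Unary.Unique.Propositional.Properties as Unique
open import Data.Nat.Base using (ℕ; zero; suc; _+_; _*_; _≤_; z≤n; s≤s)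
open import Data.Nat.Properties using (_≤?_; ≤-reflexive)
open import Data.Product.Base using (∃; _×_; _,_)
open import Data.Sum.Base using (_⊎_; inj₁; inj₂; swap)
open import Data.Unit.Base using (tt)
open import Data.Vec.Base as Vec using (Vec; []; _∷_; concat)
open import Data.Vec.Properties using (≡-dec; ∷-injective)
open import Function.Base using (_∘_)
open import Relation.Binary.Definitions using (DecidableEquality; Decidable)
open import Relation.Binary.PropositionalEquality
  using (_≡_; _≢_; refl; sym; cong; subst)
open import Relation.Nullary using (¬_; Dec; yes; no; does; contradiction)
open import Relation.Nullary.Decidable using (_×-dec_; _⊎-dec_; map′; dec-true)

record FiniteGraph : Set₁ where
  infix 4 _≟_ _~_ _~?_
  field
    Vertex   : Set
    _≟_      : DecidableEquality Vertex
    vertices : List Vertex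
    complete : ∀ v → v ∈ vertices
    unique   : Unique vertices
    _~_      : Vertex → Vertex → Set
    _~?_     : Decidable _~_
    ~-sym    : ∀ {u v} → u ~ v → v ~ u
    ~-irrefl : ∀ {v} → ¬ (v ~ v)

module DoubleDomination (Γ : FiniteGraph) where
  open FiniteGraph Γ

  VertexSet : Set
  VertexSet = Vertex → Bool

  ∣_∣ : VertexSet → ℕ
  ∣ D ∣ = length (filterᵇ D vertices)

  infixr 6 _∩_
  _∩_ : VertexSet → VertexSet → VertexSet
  (D ∩ E) v = D v ∧ E v

  N[_] : Vertex → VertexSet
  N[ v ] u = does ((u ≟ v) ⊎-dec (v ~? u))

  IsDoubleDominating : VertexSet → Set
  IsDoubleDominating D = ∀ v → 2 ≤ ∣ N[ v ] ∩ D ∣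

  IsDoubleDominationNumber : ℕ → Set
  IsDoubleDominationNumber k =
    (∃ λ (D : VertexSet) → IsDoubleDominating D × ∣ D ∣ ≡ k) ×
    (∀ (D : VertexSet) → IsDoubleDominating D → k ≤ ∣ D ∣)

  isDoubleDominating? : ∀ (D : VertexSet) → Dec (IsDoubleDominating D)
  isDoubleDominating? D =
    map′ (λ all v → All.lookup all (complete v)) (λ dd → All.universal dd vertices)
         (all? (λ v → 2 ≤? ∣ N[ v ] ∩ D ∣) vertices)

  all-vertices : VertexSet
  all-vertices _ = true

  update : Vertex → Bool → VertexSet → VertexSet
  update v b D u = if does (u ≟ v) then b else D u

  subsetsOf : List Vertex → List VertexSet
  subsetsOf []       = (λ _ → false) ∷ []
  subsetsOf (v ∷ vs) = cartesianProductWith (update v) (true ∷ false ∷ []) (subsetsOf vs)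

  -- The size of a smallest double dominating set.  all-vertices is only
  -- a default for argmin: it is double dominating whenever some set is.
  γ×2 : ℕ
  γ×2 = ∣ argmin ∣_∣ all-vertices (filter isDoubleDominating? (subsetsOf vertices)) ∣

  subsetsOf-complete : ∀ (D : VertexSet) vs →
                       ∃ λ (E : VertexSet) → E ∈ subsetsOf vs × (∀ {u} → u ∈ vs → E u ≡ D u)
  subsetsOf-complete D []       = _ , here refl , λ ()
  subsetsOf-complete D (v ∷ vs) with E , E∈ , E≗D ← subsetsOf-complete D vs =
    update v (D v) E , ∈-cartesianProductWith⁺ (update v) (bool∈ (D v)) E∈ , agree
    where
    bool∈ : ∀ b → b ∈ true ∷ false ∷ []
    bool∈ true  = here refl
    bool∈ false = there (here refl)

    agree : ∀ {u} → u ∈ v ∷ vs → update v (D v) E u ≡ D u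
    agree {u} u∈ with u ≟ v | u∈
    ... | yes refl | _         = refl
    ... | no u≢v   | here u≡v  = contradiction u≡v u≢v
    ... | no _     | there u∈′ = E≗D u∈′

  ∣∣-cong : ∀ {D E : VertexSet} → (∀ v → D v ≡ E v) → ∣ D ∣ ≡ ∣ E ∣
  ∣∣-cong {D} {E} D≗E = go vertices
    where
    go : ∀ vs → length (filterᵇ D vs) ≡ length (filterᵇ E vs)
    go []       = refl
    go (v ∷ vs) with D v | E v | D≗E v
    ... | true  | _ | refl = cong suc (go vs)
    ... | false | _ | refl = go vs

  isDoubleDominating-cong : ∀ {D E : VertexSet} → (∀ v → D v ≡ E v) →
                            IsDoubleDominating D → IsDoubleDominating E
  isDoubleDominating-cong D≗E dd v =
    subst (2 ≤_) (∣∣-cong (λ u → cong (N[ v ] u ∧_) (D≗E u))) (dd v)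

  γ×2-minimum : IsDoubleDominating all-vertices → IsDoubleDominationNumber γ×2
  γ×2-minimum dd =
    (_ , argmin-all ∣_∣ dd (all-filter isDoubleDominating? (subsetsOf vertices)) , refl) ,
    minimal
    where
    minimal : ∀ (D : VertexSet) → IsDoubleDominating D → γ×2 ≤ ∣ D ∣
    minimal D D-dd with E , E∈ , E≗D ← subsetsOf-complete D vertices =
      f[argmin]≤v⁺ {f = ∣_∣} all-vertices _
        (inj₂ (Any.map (λ {refl → ≤-reflexive (∣∣-cong (λ v → E≗D (complete v)))})
          (∈-filter⁺ isDoubleDominating? E∈
            (isDoubleDominating-cong (λ v → sym (E≗D (complete v))) D-dd))))

  two-elements : ∀ {u v} (xs : List Vertex) → u ≢ v → u ∈ xs → v ∈ xs → 2 ≤ length xs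
  two-elements (_ ∷ [])    u≢v (here refl) (here refl) = contradiction refl u≢v
  two-elements (_ ∷ _ ∷ _) _   _           _           = s≤s (s≤s z≤n)

  all-vertices-dominating : (∀ v → ∃ λ u → v ~ u) → IsDoubleDominating all-vertices
  all-vertices-dominating neighbour v with u , v~u ← neighbour v =
    two-elements _ (λ {refl → ~-irrefl v~u}) (member (inj₁ refl)) (member (inj₂ v~u))
    where
    P? : ∀ w → Dec (w ≡ v ⊎ v ~ w)
    P? w = (w ≟ v) ⊎-dec (v ~? w)

    member : ∀ {w} → w ≡ v ⊎ v ~ w → w ∈ filterᵇ (N[ v ] ∩ all-vertices) vertices
    member {w} p = ∈-filter⁺ (T? ∘ (N[ v ] ∩ all-vertices)) (complete w)
                     (subst T (sym (cong (_∧ true) (dec-true (P? w) p))) tt)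

open DoubleDomination public using (γ×2; IsDoubleDominationNumber)

_≟ᵛ_ : ∀ {n} → DecidableEquality (Vec Bool n)
_≟ᵛ_ = ≡-dec Bool._≟_

strings : ∀ n → List (Vec Bool n)
strings zero    = [] ∷ []
strings (suc n) = cartesianProductWith _∷_ (false ∷ true ∷ []) (strings n)

strings-complete : ∀ {n} (v : Vec Bool n) → v ∈ strings n
strings-complete []          = here refl
strings-complete (false ∷ v) =
  ∈-cartesianProductWith⁺ _∷_ {xs = false ∷ true ∷ []} (here refl) (strings-complete v)
strings-complete (true  ∷ v) =
  ∈-cartesianProductWith⁺ _∷_ {xs = false ∷ true ∷ []} (there (here refl)) (strings-complete v)

strings-unique : ∀ n → Unique (strings n)
strings-unique zero    = All.[] AllPairs.∷ AllPairs.[]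
strings-unique (suc n) = Unique.cartesianProductWith⁺ _∷_ ∷-injective
  (((λ ()) All.∷ All.[]) AllPairs.∷ All.[] AllPairs.∷ AllPairs.[]) (strings-unique n)

pattern 00′ = false ∷ false ∷ []
pattern 01′ = false ∷ true  ∷ []
pattern 10′ = true  ∷ false ∷ []
pattern 11′ = true  ∷ true  ∷ []

data Next : Vec Bool 2 → Vec Bool 2 → Set where
  00→01 : Next 00′ 01′
  01→11 : Next 01′ 11′
  11→10 : Next 11′ 10′
  10→00 : Next 10′ 00′

C₄ : Vec Bool 2 → Vec Bool 2 → Set
C₄ p q = Next p q ⊎ Next q p

next? : Decidable Next
next? 00′ 00′ = no λ ()
next? 00′ 01′ = yes 00→01
next? 00′ 10′ = no λ ()
next? 00′ 11′ = no λ ()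
next? 01′ 00′ = no λ ()
next? 01′ 01′ = no λ ()
next? 01′ 10′ = no λ ()
next? 01′ 11′ = yes 01→11
next? 10′ 00′ = yes 10→00
next? 10′ 01′ = no λ ()
next? 10′ 10′ = no λ ()
next? 10′ 11′ = no λ ()
next? 11′ 00′ = no λ ()
next? 11′ 01′ = no λ ()
next? 11′ 10′ = yes 11→10
next? 11′ 11′ = no λ ()

C₄? : Decidable C₄
C₄? p q = next? p q ⊎-dec next? q p

C₄-irrefl : ∀ {p} → ¬ C₄ p p
C₄-irrefl (inj₁ ())
C₄-irrefl (inj₂ ())

C₄-neighbour : ∀ p → ∃ λ q → C₄ p q
C₄-neighbour 00′ = _ , inj₁ 00→01
C₄-neighbour 01′ = _ , inj₁ 01→11
C₄-neighbour 10′ = _ , inj₁ 10→00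
C₄-neighbour 11′ = _ , inj₁ 11→10

-- With this form of the length 2l+2, prefixing two bits to a Label l gives a
-- Label (suc l) definitionally.
Label : ℕ → Set
Label l = Vec Bool (2 + l * 2)

-- 10(01)^l
link : ∀ l → Label l
link l = true ∷ false ∷ concat (Vec.replicate l 01′)

-- In Adj (suc l), the first summand gives the edges inside the copies and the
-- second one the edges between them: {00w,10w}, {10w,11w}, {11w,01w} and
-- {01w,00w}, whose prefixes are exactly the edges of the 4-cycle C₄.
Adj : ∀ l → Label l → Label l → Set
Adj zero    u           v           = C₄ u v
Adj (suc l) (a ∷ b ∷ u) (c ∷ d ∷ v) =
  ((a ≡ c × b ≡ d) × Adj l u v) ⊎
  (C₄ (a ∷ b ∷ []) (c ∷ d ∷ []) × u ≡ link l × v ≡ link l)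

adj? : ∀ l → Decidable (Adj l)
adj? zero    u           v           = C₄? u v
adj? (suc l) (a ∷ b ∷ u) (c ∷ d ∷ v) =
  (((a Bool.≟ c) ×-dec (b Bool.≟ d)) ×-dec adj? l u v) ⊎-dec
  (C₄? (a ∷ b ∷ []) (c ∷ d ∷ []) ×-dec (u ≟ᵛ link l) ×-dec (v ≟ᵛ link l))

adj-sym : ∀ l {u v} → Adj l u v → Adj l v u
adj-sym zero    e = swap e
adj-sym (suc l) {_ ∷ _ ∷ _} {_ ∷ _ ∷ _} (inj₁ ((a≡c , b≡d) , e)) =
  inj₁ ((sym a≡c , sym b≡d) , adj-sym l e)
adj-sym (suc l) {_ ∷ _ ∷ _} {_ ∷ _ ∷ _} (inj₂ (e , u≡w , v≡w)) =
  inj₂ (swap e , v≡w , u≡w)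

adj-irrefl : ∀ l {v} → ¬ Adj l v v
adj-irrefl zero    e = C₄-irrefl e
adj-irrefl (suc l) {_ ∷ _ ∷ _} (inj₁ (_ , e)) = adj-irrefl l e
adj-irrefl (suc l) {_ ∷ _ ∷ _} (inj₂ (e , _)) = C₄-irrefl e

adj-neighbour : ∀ l v → ∃ λ u → Adj l v u
adj-neighbour zero    v           = C₄-neighbour v
adj-neighbour (suc l) (a ∷ b ∷ v) with u , e ← adj-neighbour l v =
  a ∷ b ∷ u , inj₁ ((refl , refl) , e)

FCN : ℕ → FiniteGraph
FCN l = record
  { Vertex   = Label l
  ; _≟_      = _≟ᵛ_
  ; vertices = strings _
  ; complete = strings-complete
  ; unique   = strings-unique _
  ; _~_      = Adj l
  ; _~?_     = adj? l
  ; ~-sym    = adj-sym l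
  ; ~-irrefl = adj-irrefl l
  }

γ×2-FCN-minimum : ∀ l → IsDoubleDominationNumber (FCN l) (γ×2 (FCN l))
γ×2-FCN-minimum l = γ×2-minimum (all-vertices-dominating (adj-neighbour l))
  where open DoubleDomination (FCN l)

{-# OPTIONS --safe #-}
module Submission where

-- Call D ⊆ V(FCN l) sufficient when it double dominates every vertex except
-- possibly link l, and let s(l) be the minimum size of a sufficient set.  The
-- four copies of link l form a 4-cycle in FCN (l+1), while every other vertex
-- has all its neighbours in its own copy.
-- Hence the restrictions to the copies of a double dominating set are
-- sufficient; conversely, four copies of a sufficient set containing link l
-- are double dominating.  So γ×2(FCN(l+1)) = 4 s(l).
-- Moreover s(l+1) = γ×2(FCN(l+1)) − 1.  For "≥", link (l+1) has a neighbour c of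
-- degree 2 (the vertex 1 0 corner l 00 below).  To be dominated twice, c must
-- have c or link (l+1) in D, so adding the other one of these two makes D double
-- dominating.
-- For "≤", there are sufficient sets containing link l and corner l 01 such that
-- one element can be saved when corner l 01 need not be dominated either.

open import Data.Bool.Base using (Bool; true; false; T; _∧_; _∨_; not)
open import Data.Bool.Properties using (T?; T-∧; T-∨)
open import Data.List.Base
  using (List; []; _∷_; _++_; map; length; filterᵇ)
open import Data.List.Membership.Propositional using (_∈_)
open import Data.List.Membership.Propositional.Properties using (∈-filter⁺; ∈-filter⁻)
open import Data.List.Properties using (++-identityʳ; filter-++; length-++)
open import Data.List.Relation.Unary.All as All using (All)
open import Data.List.Relation.Unary.All.Properties using (all-filter)
open import Data.List.Relation.Unary.AllPairs using ([]; _∷_)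
open import Data.List.Relation.Unary.Any using (here; there)
open import Data.List.Relation.Unary.Unique.Propositional using (Unique)
open import Data.List.Relation.Unary.Unique.Propositional.Properties using (filter⁺)
open import Data.Nat.Base using (ℕ; zero; suc; _+_; _*_; _∸_; _≤_; z≤n; s≤s)
open import Data.Nat.Properties using
  ( ≤-trans; ≤-reflexive; ≤-antisym; n≤1+n; ≤-pred; +-suc; +-comm; +-monoʳ-≤; +-mono-≤
  ; module ≤-Reasoning)
open import Data.Nat.Tactic.RingSolver using (solve-∀)
open import Data.Product.Base using (∃; ∃₂; _×_; _,_; proj₂)
open import Data.Sum.Base as Sum using (_⊎_; inj₁; inj₂)
open import Data.Unit.Base using (tt)
open import Data.Vec.Base using (Vec; []; _∷_; concat; replicate)
open import Data.Vec.Properties using (∷-injectiveʳ)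
open import Function.Base using (_∘_; case_of_; id)
open import Function.Bundles using (_⇔_; mk⇔; Equivalence)
open import Relation.Binary.PropositionalEquality
open import Relation.Nullary using (¬_; Dec; yes; no; does; contradiction)
open import Relation.Nullary.Decidable using (_⊎-dec_)
open import Defs

open Equivalence using (to; from)

-- Counting elements of lists.

private variable
  A B : Set

count : (A → Bool) → List A → ℕ
count D xs = length (filterᵇ D xs)

count-map : ∀ (D : A → Bool) (f : B → A) xs →
            count D (map f xs) ≡ count (D ∘ f) xs
count-map D f []       = refl
count-map D f (x ∷ xs) with D (f x)
... | true  = cong suc (count-map D f xs)
... | false = count-map D f xs

count-++ : ∀ (D : A → Bool) xs ys → count D (xs ++ ys) ≡ count D xs + count D ys
count-++ D xs ys = trans (cong length (filter-++ (T? ∘ D) xs ys)) (length-++ (filterᵇ D xs))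

count-∨ : ∀ (D E : A → Bool) xs → count (λ x → D x ∨ E x) xs ≤ count D xs + count E xs
count-∨ D E []       = z≤n
count-∨ D E (x ∷ xs) with D x | E x | count-∨ D E xs
... | true  | true  | ih = s≤s (≤-trans ih (+-monoʳ-≤ (count D xs) (n≤1+n _)))
... | true  | false | ih = s≤s ih
... | false | true  | ih = ≤-trans (s≤s ih) (≤-reflexive (sym (+-suc (count D xs) _)))
... | false | false | ih = ih

unique-constant : ∀ {x : A} {xs} → Unique xs → All (_≡ x) xs → length xs ≤ 1
unique-constant {xs = []}        _ _ = z≤n
unique-constant {xs = _ ∷ []}    _ _ = s≤s z≤n
unique-constant {xs = _ ∷ _ ∷ _} ((y≢z All.∷ _) ∷ _) (y≡x All.∷ z≡x All.∷ _) =
  contradiction (trans y≡x (sym z≡x)) y≢z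

T-does : ∀ {P : Set} (P? : Dec P) → T (does P?) ⇔ P
T-does (yes p) = mk⇔ (λ _ → p) _
T-does (no ¬p) = mk⇔ (λ ()) ¬p

-- Double domination through pairs of witnesses.

module _ (Γ : FiniteGraph) where
  open FiniteGraph Γ
  open DoubleDomination Γ using (VertexSet; ∣_∣; N[_]; _∩_; two-elements)

  infix 4 _∈N[_]
  _∈N[_] : Vertex → Vertex → Set
  u ∈N[ v ] = u ≡ v ⊎ v ~ u

  -- Explicit witnesses can be carried between a copy and the whole graph without any counting.
  DominatedTwice : VertexSet → Vertex → Set
  DominatedTwice D v = ∃₂ λ u u′ →
    u ≢ u′ × (u ∈N[ v ] × T (D u)) × (u′ ∈N[ v ] × T (D u′))

  private
    N? : ∀ v u → Dec (u ∈N[ v ])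
    N? v u = (u ≟ v) ⊎-dec (v ~? u)

  dominatedTwice⇒2≤ : ∀ {D v} → DominatedTwice D v → 2 ≤ ∣ N[ v ] ∩ D ∣
  dominatedTwice⇒2≤ {D} {v} (u , u′ , u≢u′ , u∈ , u′∈) =
    two-elements _ u≢u′ (member u∈) (member u′∈)
    where
    member : ∀ {w} → w ∈N[ v ] × T (D w) → w ∈ filterᵇ (N[ v ] ∩ D) vertices
    member {w} (w∈N , w∈D) = ∈-filter⁺ (T? ∘ (N[ v ] ∩ D)) (complete w)
      (from T-∧ (from (T-does (N? v w)) w∈N , w∈D))

  2≤⇒dominatedTwice : ∀ {D v} → 2 ≤ ∣ N[ v ] ∩ D ∣ → DominatedTwice D v
  2≤⇒dominatedTwice {D} {v} 2≤ = go _ 2≤ (filter⁺ _ unique) λ w∈ →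
    let w∈N , w∈D = to T-∧ (proj₂ (∈-filter⁻ (T? ∘ (N[ v ] ∩ D)) {xs = vertices} w∈))
    in to (T-does (N? v _)) w∈N , w∈D
    where
    go : ∀ ws → 2 ≤ length ws → Unique ws →
         (∀ {w} → w ∈ ws → w ∈N[ v ] × T (D w)) → DominatedTwice D v
    go (_ ∷ [])    (s≤s ())
    go (u ∷ u′ ∷ _) _ ((u≢u′ All.∷ _) ∷ _) f =
      u , u′ , u≢u′ , f (here refl) , f (there (here refl))

  dominatedTwice-mono : ∀ {D E} → (∀ u → T (D u) → T (E u)) →
                        ∀ {v} → DominatedTwice D v → DominatedTwice E v
  dominatedTwice-mono D⊆E (u , u′ , u≢u′ , (u∈N , u∈D) , (u′∈N , u′∈D)) =
    u , u′ , u≢u′ , (u∈N , D⊆E u u∈D) , (u′∈N , D⊆E u′ u′∈D)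

  dominationNumber-≡ : ∀ {k n} → IsDoubleDominationNumber Γ k →
    (∃ λ D → (∀ v → DominatedTwice D v) × ∣ D ∣ ≡ n) →
    (∀ D → (∀ v → DominatedTwice D v) → n ≤ ∣ D ∣) → k ≡ n
  dominationNumber-≡ ((D , D-dom , ∣D∣≡k) , minimal) (E , E-dom , ∣E∣≡n) n≤ = ≤-antisym
    (subst (_ ≤_) ∣E∣≡n (minimal E (dominatedTwice⇒2≤ ∘ E-dom)))
    (subst (_ ≤_) ∣D∣≡k (n≤ D (2≤⇒dominatedTwice ∘ D-dom)))

  insert : Vertex → VertexSet → VertexSet
  insert v D u = D u ∨ does (u ≟ v)

  ∣insert∣≤ : ∀ v D → ∣ insert v D ∣ ≤ suc ∣ D ∣
  ∣insert∣≤ v D = begin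
    ∣ insert v D ∣                                 ≤⟨ count-∨ D (λ u → does (u ≟ v)) vertices ⟩
    ∣ D ∣ + ∣ (λ u → does (u ≟ v)) ∣               ≤⟨ +-monoʳ-≤ ∣ D ∣ singleton ⟩
    ∣ D ∣ + 1                                      ≡⟨ +-comm ∣ D ∣ 1 ⟩
    suc ∣ D ∣                                      ∎
    where
    open ≤-Reasoning
    P? = λ u → T? (does (u ≟ v))
    singleton : ∣ (λ u → does (u ≟ v)) ∣ ≤ 1
    singleton = unique-constant (filter⁺ P? unique)
      (All.map (λ {u} → to (T-does (u ≟ v))) (all-filter P? vertices))

  insert-⊇ : ∀ v D u → T (D u) → T (insert v D u)
  insert-⊇ v D u u∈D = from T-∨ (inj₁ u∈D)

  ∈-insert : ∀ v D → T (insert v D v)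
  ∈-insert v D = from T-∨ (inj₂ (from (T-does (v ≟ v)) refl))

-- Sizes of sets of strings, split over the four copies.

size : ∀ {n} → (Vec Bool n → Bool) → ℕ
size {n} D = count D (strings n)

size-∷ : ∀ {n} (D : Vec Bool (suc n) → Bool) →
         size D ≡ size (D ∘ (false ∷_)) + size (D ∘ (true ∷_))
size-∷ {n} D = begin
  size D
    ≡⟨ count-++ D (map (false ∷_) (strings n)) _ ⟩
  count D (map (false ∷_) (strings n)) + count D (map (true ∷_) (strings n) ++ [])
    ≡⟨ cong₂ _+_ (count-map D _ (strings n))
         (trans (cong (count D) (++-identityʳ (map (true ∷_) (strings n))))
                (count-map D _ (strings n))) ⟩
  size (D ∘ (false ∷_)) + size (D ∘ (true ∷_)) ∎
  where open ≡-Reasoning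

copy : ∀ {n} → Bool → Bool → (Vec Bool (2 + n) → Bool) → Vec Bool n → Bool
copy a b D v = D (a ∷ b ∷ v)

size-copies : ∀ {n} (D : Vec Bool (2 + n) → Bool) →
  size D ≡ (size (copy false false D) + size (copy false true D)) +
           (size (copy true  false D) + size (copy true  true D))
size-copies D =
  trans (size-∷ D) (cong₂ _+_ (size-∷ (D ∘ (false ∷_))) (size-∷ (D ∘ (true ∷_))))

-- Corners and the link vertex.

-- (01)^l q
corner : ∀ l → Vec Bool 2 → Label l
corner zero    q = q
corner (suc l) q = false ∷ true ∷ corner l q

-- This places `link (suc l)` in copy 10, where it is the corner ending in 01.
link-suc : ∀ l → link (suc l) ≡ true ∷ false ∷ corner l 01′
link-suc l = cong (λ v → true ∷ false ∷ v) (go l)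
  where
  go : ∀ l → concat (replicate (suc l) 01′) ≡ corner l 01′
  go zero    = refl
  go (suc l) = cong (λ v → false ∷ true ∷ v) (go l)

corner-00≢link : ∀ l → corner l 00′ ≢ link l
corner-00≢link zero    ()
corner-00≢link (suc l) ()

corner-00≢01 : ∀ l → corner l 00′ ≢ corner l 01′
corner-00≢01 zero    ()
corner-00≢01 (suc l) = corner-00≢01 l ∘ ∷-injectiveʳ ∘ ∷-injectiveʳ

corner-00~01 : ∀ l → Adj l (corner l 00′) (corner l 01′)
corner-00~01 zero    = inj₁ 00→01
corner-00~01 (suc l) = inj₁ ((refl , refl) , corner-00~01 l)

-- A corner starts as 00 in a 4-cycle, with two neighbours. It gains no edge at any level, because
-- its first bit differs from that of `link`.
corner-neighbours : ∀ l {u} → Adj l (corner l 00′) u → u ≡ corner l 01′ ⊎ u ≡ corner l 10′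
corner-neighbours zero (inj₁ 00→01) = inj₁ refl
corner-neighbours zero (inj₂ 10→00) = inj₂ refl
corner-neighbours (suc l) {_ ∷ _ ∷ _} (inj₁ ((refl , refl) , e)) =
  Sum.map (cong _) (cong _) (corner-neighbours l e)
corner-neighbours (suc l) {_ ∷ _ ∷ _} (inj₂ (_ , c≡w , _)) =
  contradiction c≡w (corner-00≢link l)

-- Domination inside a copy.

∈N-copy⁺ : ∀ l {a b u v} → _∈N[_] (FCN l) u v → _∈N[_] (FCN (suc l)) (a ∷ b ∷ u) (a ∷ b ∷ v)
∈N-copy⁺ l (inj₁ refl) = inj₁ refl
∈N-copy⁺ l (inj₂ e)    = inj₂ (inj₁ ((refl , refl) , e))

-- Edges between copies meet a copy only in `link l`.
∈N-copy⁻ : ∀ l {a b u v} → v ≢ link l → _∈N[_] (FCN (suc l)) u (a ∷ b ∷ v) →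
           ∃ λ u′ → u ≡ a ∷ b ∷ u′ × _∈N[_] (FCN l) u′ v
∈N-copy⁻ l v≢w (inj₁ refl) = _ , refl , inj₁ refl
∈N-copy⁻ l {u = _ ∷ _ ∷ _} v≢w (inj₂ (inj₁ ((refl , refl) , e))) = _ , refl , inj₂ e
∈N-copy⁻ l {u = _ ∷ _ ∷ _} v≢w (inj₂ (inj₂ (_ , v≡w , _))) = contradiction v≡w v≢w

dominatedTwice-copy⁺ : ∀ l {D a b v} → DominatedTwice (FCN l) (copy a b D) v →
                       DominatedTwice (FCN (suc l)) D (a ∷ b ∷ v)
dominatedTwice-copy⁺ l (u , u′ , u≢u′ , (u∈N , u∈D) , (u′∈N , u′∈D)) =
  _ , _ , u≢u′ ∘ ∷-injectiveʳ ∘ ∷-injectiveʳ , (∈N-copy⁺ l u∈N , u∈D) , (∈N-copy⁺ l u′∈N , u′∈D)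

dominatedTwice-copy⁻ : ∀ l {D a b v} → v ≢ link l →
                       DominatedTwice (FCN (suc l)) D (a ∷ b ∷ v) →
                       DominatedTwice (FCN l) (copy a b D) v
dominatedTwice-copy⁻ l v≢w (u , u′ , u≢u′ , (u∈N , u∈D) , (u′∈N , u′∈D))
  with ∈N-copy⁻ l v≢w u∈N | ∈N-copy⁻ l v≢w u′∈N
... | _ , refl , u∈N′ | _ , refl , u′∈N′ =
  _ , _ , u≢u′ ∘ cong _ , (u∈N′ , u∈D) , (u′∈N′ , u′∈D)

link-dominatedTwice : ∀ l {D} → (∀ a b → T (copy a b D (link l))) →
                      ∀ a b → DominatedTwice (FCN (suc l)) D (a ∷ b ∷ link l)
link-dominatedTwice l {D} w∈D a b with C₄-neighbour (a ∷ b ∷ [])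
... | c ∷ d ∷ [] , e =
  _ , c ∷ d ∷ link l , (λ {refl → C₄-irrefl e}) ,
  (inj₁ refl , w∈D a b) , (inj₂ (inj₂ (e , refl , refl)) , w∈D c d)

-- Small sufficient sets.

-- sparse l true is one element smaller than sparse l false; the price is that
-- corner l 01′ need not be dominated twice.
sparse : ∀ l → Bool → Label l → Bool
sparse zero    b 00′ = not b
sparse zero    b 01′ = true
sparse zero    b 10′ = true
sparse zero    b 11′ = false
sparse (suc l) b (false ∷ false ∷ v) = sparse l false v
sparse (suc l) b (false ∷ true  ∷ v) = sparse l b v
sparse (suc l) b (true  ∷ false ∷ v) = sparse l true v
sparse (suc l) b (true  ∷ true  ∷ v) = sparse l false v

-- The corner stays in copy 01 at every level and ends at 01 in the 4-cycle, which is chosen for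
-- either `b`.
corner∈sparse : ∀ l b → T (sparse l b (corner l 01′))
corner∈sparse zero    b = tt
corner∈sparse (suc l) b = corner∈sparse l b

link∈sparse : ∀ l b → T (sparse l b (link l))
link∈sparse zero    b = tt
link∈sparse (suc l) b =
  subst (T ∘ sparse (suc l) b) (sym (link-suc l)) (corner∈sparse l true)

link∈copy : ∀ l b c d → T (copy c d (sparse (suc l) b) (link l))
link∈copy l b false false = link∈sparse l false
link∈copy l b false true  = link∈sparse l b
link∈copy l b true  false = link∈sparse l true
link∈copy l b true  true  = link∈sparse l false

-- The four copies of `link l` all belong to the set and dominate each other around their 4-cycle;
-- other vertices are handled inside their copies. Copy 10 can use the smaller set because the
-- corner that it neglects is `link (suc l)`, which is exempt. Copy 01 inherits `b` because its
-- neglected corner is `corner (suc l) 01′`.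
sparse-dominates : ∀ l b v → v ≢ link l → (T b → v ≢ corner l 01′) →
                   DominatedTwice (FCN l) (sparse l b) v
sparse-dominates zero b 00′ _ _ =
  01′ , 10′ , (λ ()) , (inj₂ (inj₁ 00→01) , tt) , (inj₂ (inj₂ 10→00) , tt)
sparse-dominates zero b 11′ _ _ =
  01′ , 10′ , (λ ()) , (inj₂ (inj₂ 01→11) , tt) , (inj₂ (inj₁ 11→10) , tt)
sparse-dominates zero b 10′ v≢w _ = contradiction refl v≢w
sparse-dominates zero true  01′ _ v≢c = contradiction refl (v≢c tt)
-- The neighbour 11 is never chosen, so 01 relies on 00, the element that `b = true` drops.
sparse-dominates zero false 01′ _ _ =
  01′ , 00′ , (λ ()) , (inj₁ refl , tt) , (inj₂ (inj₂ 00→01) , tt)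
sparse-dominates (suc l) b (c ∷ d ∷ v) v≢w v≢c with v ≟ᵛ link l
... | yes refl = link-dominatedTwice l (link∈copy l b) c d
... | no v≢link = dominatedTwice-copy⁺ l (in-copy c d v≢w v≢c)
  where
  in-copy : ∀ c d → c ∷ d ∷ v ≢ link (suc l) → (T b → c ∷ d ∷ v ≢ corner (suc l) 01′) →
            DominatedTwice (FCN l) (copy c d (sparse (suc l) b)) v
  in-copy false false _   _   = sparse-dominates l false v v≢link λ ()
  in-copy false true  _   v≢c =
    sparse-dominates l b v v≢link λ t v≡c → v≢c t (cong _ v≡c)
  in-copy true  false v≢w _   = sparse-dominates l true v v≢link λ _ v≡c →
    v≢w (trans (cong _ v≡c) (sym (link-suc l)))
  in-copy true  true  _   _   = sparse-dominates l false v v≢link λ ()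

-- The size of one explicit sufficient set; `sufficient⇒s≤` shows that it is the minimum.
s : ℕ → ℕ
s l = size (sparse l false)

suc-inner-sum : ∀ f t → suc ((f + t) + (t + f)) ≡ (f + suc t) + (t + f)
suc-inner-sum = solve-∀

suc-outer-sum : ∀ f t → suc ((f + f) + (t + f)) ≡ (f + f) + (suc t + f)
suc-outer-sum = solve-∀

4*-sum : ∀ x → (x + x) + (x + x) ≡ 4 * x
4*-sum = solve-∀

-- The flag is passed to copy 01 alone, so exactly one element is saved at each level.
suc-size-sparse-true : ∀ l → suc (size (sparse l true)) ≡ s l
suc-size-sparse-true zero    = refl
suc-size-sparse-true (suc l) = begin
  suc (size (sparse (suc l) true))  ≡⟨ cong suc (size-copies (sparse (suc l) true)) ⟩
  suc ((s l + t) + (t + s l))       ≡⟨ suc-inner-sum (s l) t ⟩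
  (s l + suc t) + (t + s l)         ≡⟨ cong (λ x → (s l + x) + (t + s l)) (suc-size-sparse-true l) ⟩
  (s l + s l) + (t + s l)           ≡⟨ size-copies (sparse (suc l) false) ⟨
  s (suc l)                         ∎
  where
  open ≡-Reasoning
  t = size (sparse l true)

-- The missing element is the one saved in copy 10.
suc-s-suc : ∀ l → suc (s (suc l)) ≡ 4 * s l
suc-s-suc l = begin
  suc (s (suc l))                   ≡⟨ cong suc (size-copies (sparse (suc l) false)) ⟩
  suc ((s l + s l) + (t + s l))     ≡⟨ suc-outer-sum (s l) t ⟩
  (s l + s l) + (suc t + s l)       ≡⟨ cong (λ x → (s l + s l) + (x + s l)) (suc-size-sparse-true l) ⟩
  (s l + s l) + (s l + s l)         ≡⟨ 4*-sum (s l) ⟩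
  4 * s l                           ∎
  where
  open ≡-Reasoning
  t = size (sparse l true)

-- The lower bound.

Sufficient : ∀ l → (Label l → Bool) → Set
Sufficient l D = ∀ v → v ≢ link l → DominatedTwice (FCN l) D v

-- The closed neighbourhood of c consists of c, `link (suc l)` and one further vertex, and two
-- distinct witnesses cannot both be the latter.
c∈D⊎link∈D : ∀ l {D} → Sufficient (suc l) D →
             T (D (true ∷ false ∷ corner l 00′)) ⊎ T (D (link (suc l)))
c∈D⊎link∈D l {D} suff with suff c c≢link
  where
  c = true ∷ false ∷ corner l 00′
  c≢link : c ≢ link (suc l)
  c≢link c≡w = corner-00≢01 l (∷-injectiveʳ (∷-injectiveʳ (trans c≡w (link-suc l))))
... | u , u′ , u≢u′ , (u∈N , u∈D) , (u′∈N , u′∈D)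
  with ∈N-copy⁻ l (corner-00≢link l) u∈N | ∈N-copy⁻ l (corner-00≢link l) u′∈N
... | _ , refl , inj₁ refl | _ = inj₁ u∈D
... | _ | _ , refl , inj₁ refl = inj₁ u′∈D
... | _ , refl , inj₂ e | _ , refl , inj₂ e′ with corner-neighbours l e | corner-neighbours l e′
... | inj₁ refl | _         = inj₂ (subst (T ∘ D) (sym (link-suc l)) u∈D)
... | _         | inj₁ refl = inj₂ (subst (T ∘ D) (sym (link-suc l)) u′∈D)
... | inj₂ refl | inj₂ refl = contradiction refl u≢u′

-- Only `link (suc l)` is left to check: it is dominated by itself and by its neighbour c.
sufficient⇒dominates : ∀ l {D E} → Sufficient (suc l) D → (∀ u → T (D u) → T (E u)) →
  T (E (true ∷ false ∷ corner l 00′)) → T (E (link (suc l))) →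
  ∀ v → DominatedTwice (FCN (suc l)) E v
sufficient⇒dominates l {D} {E} suff D⊆E c∈E w∈E v with v ≟ᵛ link (suc l)
... | no v≢w   = dominatedTwice-mono (FCN (suc l)) D⊆E (suff v v≢w)
... | yes refl rewrite link-suc l =
  _ , true ∷ false ∷ corner l 00′ ,
  corner-00≢01 l ∘ sym ∘ ∷-injectiveʳ ∘ ∷-injectiveʳ , (inj₁ refl , w∈E) ,
  (inj₂ (inj₁ ((refl , refl) , adj-sym l {corner l 00′} (corner-00~01 l))) , c∈E)

sufficient-extension : ∀ l {D} → Sufficient (suc l) D →
  ∃ λ E → (∀ v → DominatedTwice (FCN (suc l)) E v) × size E ≤ suc (size D)
sufficient-extension l {D} suff = case c∈D⊎link∈D l suff of λ where
    (inj₁ c∈D) → insert Γ w D ,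
      sufficient⇒dominates l suff (insert-⊇ Γ w D) (insert-⊇ Γ w D c c∈D) (∈-insert Γ w D) ,
      ∣insert∣≤ Γ w D
    (inj₂ w∈D) → insert Γ c D ,
      sufficient⇒dominates l suff (insert-⊇ Γ c D) (∈-insert Γ c D) (insert-⊇ Γ c D w w∈D) ,
      ∣insert∣≤ Γ c D
  where
  Γ = FCN (suc l)
  w = link (suc l)
  c = true ∷ false ∷ corner l 00′

-- p, q, r and t say whether 00, 01, 10 and 11 belong to a subset of the 4-cycle.
3≤count : ∀ p q r t →
  2 ≤ count id (p ∷ q ∷ r ∷ false ∷ []) → 2 ≤ count id (p ∷ q ∷ false ∷ t ∷ []) →
  2 ≤ count id (false ∷ q ∷ r ∷ t ∷ []) → 3 ≤ count id (p ∷ q ∷ r ∷ t ∷ [])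
3≤count true  true  true  _     _        _        _        = s≤s (s≤s (s≤s z≤n))
3≤count true  true  false true  _        _        _        = s≤s (s≤s (s≤s z≤n))
3≤count true  false true  true  _        _        _        = s≤s (s≤s (s≤s z≤n))
3≤count false true  true  true  _        _        _        = s≤s (s≤s (s≤s z≤n))
3≤count true  true  false false _        _        (s≤s ())
3≤count true  false true  false _        (s≤s ()) _
3≤count true  false false _     (s≤s ()) _        _
3≤count false true  false _     (s≤s ()) _        _
3≤count false true  true  false _        (s≤s ()) _
3≤count false false true  _     (s≤s ()) _        _
3≤count false false false _     ()       _        _

-- A two-element `D` would lie in the closed neighbourhoods of 00, 01 and 11, whose only common
-- vertex is 01.
3≤size : ∀ {D} → Sufficient 0 D → 3 ≤ size D
3≤size {D} suff = subst (3 ≤_) (count-map id D (strings 2))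
  (3≤count (D 00′) (D 01′) (D 10′) (D 11′)
    (at 00′ (λ ())) (at 01′ (λ ())) (at 11′ (λ ())))
  where
  open DoubleDomination (FCN 0) using (N[_]; _∩_)
  -- Over the mapped list the neighbourhood of a concrete `v` computes, leaving `false` at the one
  -- vertex outside it.
  at : ∀ v → v ≢ link 0 → 2 ≤ count id (map (N[ v ] ∩ D) (strings 2))
  at v v≢w = subst (2 ≤_) (sym (count-map id (N[ v ] ∩ D) (strings 2)))
    (dominatedTwice⇒2≤ (FCN 0) (suff v v≢w))

mutual
  -- The two bounds alternate: extending a sufficient set costs one element, and restricting a
  -- dominating set to its copies lowers `l`.
  sufficient⇒s≤ : ∀ l {D} → Sufficient l D → s l ≤ size D
  sufficient⇒s≤ zero    {D} suff = 3≤size suff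
  sufficient⇒s≤ (suc l) {D} suff with E , dom , E≤ ← sufficient-extension l suff = ≤-pred (begin
    suc (s (suc l)) ≡⟨ suc-s-suc l ⟩
    4 * s l         ≤⟨ dominating⇒4*s≤ l dom ⟩
    size E          ≤⟨ E≤ ⟩
    suc (size D)    ∎)
    where open ≤-Reasoning

  dominating⇒4*s≤ : ∀ l {D} → (∀ v → DominatedTwice (FCN (suc l)) D v) → 4 * s l ≤ size D
  dominating⇒4*s≤ l {D} dom = begin
    4 * s l                       ≡⟨ 4*-sum (s l) ⟨
    (s l + s l) + (s l + s l)     ≤⟨ +-mono-≤ (+-mono-≤ (bound _ _) (bound _ _))
                                              (+-mono-≤ (bound _ _) (bound _ _)) ⟩
    _                             ≡⟨ size-copies D ⟨
    size D                        ∎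
    where
    open ≤-Reasoning
    bound : ∀ a b → s l ≤ size (copy a b D)
    bound a b = sufficient⇒s≤ l λ v v≢w → dominatedTwice-copy⁻ l v≢w (dom (a ∷ b ∷ v))

-- The value of the double domination number.

-- In contrast to `sparse (suc l) false`, copy 10 keeps its extra element, since `link (suc l)` must
-- now be dominated twice as well.
copies : ∀ l → Label (suc l) → Bool
copies l (_ ∷ _ ∷ v) = sparse l false v

copies-dominates : ∀ l v → DominatedTwice (FCN (suc l)) (copies l) v
copies-dominates l (a ∷ b ∷ v) with v ≟ᵛ link l
... | yes refl = link-dominatedTwice l (λ _ _ → link∈sparse l false) a b
... | no v≢w   = dominatedTwice-copy⁺ l (sparse-dominates l false v v≢w λ ())

γ×2-suc : ∀ l → γ×2 (FCN (suc l)) ≡ 4 * s l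
γ×2-suc l = dominationNumber-≡ (FCN (suc l)) (γ×2-FCN-minimum (suc l))
  (copies l , copies-dominates l , trans (size-copies (copies l)) (4*-sum (s l)))
  (λ _ → dominating⇒4*s≤ l)

theorem25 : (l : ℕ) → 2 ≤ l → γ×2 (FCN l) ≡ 4 * (γ×2 (FCN (l ∸ 1)) ∸ 1)
theorem25 (suc zero)    (s≤s ())
theorem25 (suc (suc l)) _ = begin
  γ×2 (FCN (suc (suc l)))         ≡⟨ γ×2-suc (suc l) ⟩
  -- Here `s (suc l)` is `suc (s (suc l)) ∸ 1` by computation.
  4 * s (suc l)                   ≡⟨ cong (λ n → 4 * (n ∸ 1)) (suc-s-suc l) ⟩
  4 * (4 * s l ∸ 1)               ≡⟨ cong (λ n → 4 * (n ∸ 1)) (γ×2-suc l) ⟨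
  4 * (γ×2 (FCN (suc l)) ∸ 1)     ∎
  where open ≡-Reasoning
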